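{- The binary period-doubling sequence $\mathbf{P}_2$ can be uniquely factored into kernel words as follows: $$\mathbf{P}_2=\prod_{i\ge 1}R_i = 0\cdot 1\cdot 000\cdot 10101\cdot 00010001000\cdots .$$
   Context: Let $s_2$ be the morphism of $\{0,1\}^*$ with $s_2(0)=01$, $s_2(1)=00$. The binary period-doubling sequence $\mathbf{P}_2=\lim_{n\to\infty}s_2^n(0)$ is the infinite fixed point of $s_2$ beginning with $0$. For a finite word $u$ beginning with $0$, $0^{ -1}u$ denotes $u$ with its first letter deleted. The kernel words of $\mathbf{P}_2$ are the words $R_i$ ($i\ge 0$) defined by $R_0=\varepsilon$ (the empty word), $R_1=0$, $R_2=1$, $R_3=000$, $R_4=10101$, and, for $i>4$, $R_i=0^{ -1}s_2(R_{i-1})$ if $i$ is even and $R_i=s_2(R_{i-1})0$ otherwise. The infinite product $\prod_{i\ge1}R_i$ is the concatenation $R_1R_2R_3\cdots$.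
   Formalization: Uniqueness is proved among factorizations into nonempty, pairwise distinct kernel words (in any order); without this it fails, since R_1 = 0 and R_2 = 1 are the letters, so P_2 written letter by letter is another factorization, and R_0 = ε can be inserted anywhere. -}

module Defs where

open import Data.Fin.Base using (Fin; fromℕ<)
open import Data.Fin.Patterns using (0F; 1F)
open import Data.List.Base
  using (List; []; _∷_; [_]; _++_; length; lookup; drop; take; concat; concatMap; applyUpTo)
open import Data.List.Properties using (concatMap-++; ++-assoc; ++-identityʳ)
open import Data.Nat.Base
  using (ℕ; zero; suc; _+_; _≤_; _<_; _≥_; s≤s; s≤s⁻¹; z<s; parity)
open import Data.Nat.GeneralisedArithmetic using (fold)
open import Data.Nat.Properties
  using (<-≤-trans; ≤-trans; m≤n+m; n≤1+n; +-suc; +-identityʳ; m≤n⇒∃[o]m+o≡n)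
open import Data.Parity.Base using (Parity; 0ℙ; 1ℙ)
open import Data.Product.Base using (∃-syntax; _,_)
open import Function.Definitions using (Injective)
open import Relation.Binary.PropositionalEquality
  using (_≡_; _≢_; refl; sym; trans; cong; cong₂; subst)

Letter : Set
Letter = Fin 2

Word : Set
Word = List Letter

InfiniteWord : Set
InfiniteWord = ℕ → Letter

-- Convergence in the prefix topology: every prefix of x is eventually a
-- prefix of uₙ.  The equation forces m ≤ length (u n), so the lengths of the
-- uₙ tend to infinity.
_⟶_ : (ℕ → Word) → InfiniteWord → Set
u ⟶ x = ∀ m → ∃[ N ] (∀ n → n ≥ N → take m (u n) ≡ applyUpTo x m)

-- x is the concatenation w₀ w₁ w₂ ⋯
_≈∏_ : InfiniteWord → (ℕ → Word) → Set
x ≈∏ w = (λ n → concat (applyUpTo w n)) ⟶ x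

s₂-letter : Letter → Word
s₂-letter 0F = 0F ∷ 1F ∷ []
s₂-letter 1F = 0F ∷ 0F ∷ []

s₂ : Word → Word
s₂ = concatMap s₂-letter

s₂^_[0] : ℕ → Word
s₂^ n [0] = fold [ 0F ] s₂ n

private
  length-s₂ : ∀ w → length (s₂ w) ≡ length w + length w
  length-s₂ []       = refl
  length-s₂ (0F ∷ w) = cong suc (trans (cong suc (length-s₂ w)) (sym (+-suc _ _)))
  length-s₂ (1F ∷ w) = cong suc (trans (cong suc (length-s₂ w)) (sym (+-suc _ _)))

  1+n<l+l : ∀ {n l} → n < l → suc n < l + l
  1+n<l+l {l = suc l} n<l = s≤s (≤-trans n<l (m≤n+m (suc l) l))

n<length-s₂^n[0] : ∀ n → n < length (s₂^ n [0])
n<length-s₂^n[0] zero    = z<s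
n<length-s₂^n[0] (suc n) =
  subst (suc n <_) (sym (length-s₂ (s₂^ n [0]))) (1+n<l+l (n<length-s₂^n[0] n))

-- Each s₂ⁿ(0) is a prefix of the next one and has length greater than n, so
-- the letter of the limit at position n can be read off s₂ⁿ(0); see P₂-limit.
P₂ : InfiniteWord
P₂ n = lookup (s₂^ n [0]) (fromℕ< (n<length-s₂^n[0] n))

private
  s₂^-step : ∀ n → ∃[ v ] s₂^ suc n [0] ≡ s₂^ n [0] ++ v
  s₂^-step zero    = [ 1F ] , refl
  s₂^-step (suc n) with s₂^-step n
  ... | v , eq = s₂ v , trans (cong s₂ eq) (concatMap-++ s₂-letter (s₂^ n [0]) v)

  s₂^-prefix : ∀ n k → ∃[ v ] s₂^ (n + k) [0] ≡ s₂^ n [0] ++ v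
  s₂^-prefix n zero = [] , trans (cong s₂^_[0] (+-identityʳ n)) (sym (++-identityʳ _))
  s₂^-prefix n (suc k) with s₂^-prefix n k | s₂^-step (n + k)
  ... | v , eq | v′ , eq′ = v ++ v′ ,
    trans (cong s₂^_[0] (+-suc n k))
      (trans eq′ (trans (cong (_++ v′) eq) (++-assoc (s₂^ n [0]) v v′)))

  lookup-prefix : ∀ {i} (u v w : Word) → w ≡ u ++ v →
                  (p : i < length u) (q : i < length w) →
                  lookup w (fromℕ< q) ≡ lookup u (fromℕ< p)
  lookup-prefix {zero}  (a ∷ u) v _ refl p q = refl
  lookup-prefix {suc i} (a ∷ u) v _ refl p q = lookup-prefix u v _ refl (s≤s⁻¹ p) (s≤s⁻¹ q)

  take-applyUpTo : ∀ m (w : Word) (x : InfiniteWord) → m ≤ length w →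
                   (∀ i → i < m → (q : i < length w) → lookup w (fromℕ< q) ≡ x i) →
                   take m w ≡ applyUpTo x m
  take-applyUpTo zero    w       x _ _ = refl
  take-applyUpTo (suc m) (a ∷ w) x p h = cong₂ _∷_ (h 0 z<s z<s)
    (take-applyUpTo m w (λ i → x (suc i)) (s≤s⁻¹ p)
      (λ i i<m q → h (suc i) (s≤s i<m) (s≤s q)))

P₂-limit : s₂^_[0] ⟶ P₂
P₂-limit m = m , λ n m≤n →
  take-applyUpTo m (s₂^ n [0]) P₂
    (≤-trans m≤n (≤-trans (n≤1+n n) (n<length-s₂^n[0] n)))
    (λ i i<m q → letter n i (≤-trans (n≤1+n i) (<-≤-trans i<m m≤n)) q)
  where
  letter : ∀ n i → i ≤ n → (q : i < length (s₂^ n [0])) →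
           lookup (s₂^ n [0]) (fromℕ< q) ≡ P₂ i
  letter n i i≤n q with m≤n⇒∃[o]m+o≡n i≤n
  ... | k , refl with s₂^-prefix i k
  ... | v , eq = lookup-prefix (s₂^ i [0]) v (s₂^ (i + k) [0]) eq (n<length-s₂^n[0] i) q

-- Deletes the first letter; only meaningful for words beginning with 0, which
-- is the case for s₂ w as soon as w is nonempty.
0⁻¹_ : Word → Word
0⁻¹ u = drop 1 u

-- The passage from Rᵢ₋₁ to Rᵢ for i > 4, given the parity of i.
kernelStep : Parity → Word → Word
kernelStep 0ℙ r = 0⁻¹ s₂ r
kernelStep 1ℙ r = s₂ r ++ [ 0F ]

R : ℕ → Word
R 0 = []
R 1 = 0F ∷ []
R 2 = 1F ∷ []
R 3 = 0F ∷ 0F ∷ 0F ∷ []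
R 4 = 1F ∷ 0F ∷ 1F ∷ 0F ∷ 1F ∷ []
R (suc i@(suc (suc (suc (suc _))))) = kernelStep (parity (suc i)) (R i)

-- A factorization of x into nonempty, pairwise distinct kernel words.
-- Distinctness is needed for uniqueness: R₁ = 0 and R₂ = 1 are the two
-- letters, so every infinite word is also a product of copies of R₁ and R₂.
record KernelFactorization (x : InfiniteWord) (w : ℕ → Word) : Set where
  field
    kernel   : ∀ k → ∃[ i ] w k ≡ R i
    nonempty : ∀ k → w k ≢ []
    distinct : Injective _≡_ _≡_ w
    product  : x ≈∏ w

{-# OPTIONS --safe #-}
-- The recursion for Rᵢ holds from R₀ = ε on, and in the form
--   pad i ++ Rᵢ₊₁ = s₂ Rᵢ ++ pad (i + 1),   pad i = ε or 0 for i even or odd,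
-- it telescopes to pad k ++ Rₖ₊₁⋯Rₖ₊ₘ = s₂ (Rₖ⋯Rₖ₊ₘ₋₁) ++ pad (k + m).
-- With k = 0 this gives by induction on n that R₁⋯Rₙ is a prefix of s₂ⁿ(0).
-- For uniqueness, suppose that the first k − 1 factors are R₁, …, Rₖ₋₁.  Then
-- the next one is some Rⱼ with j ≥ k.  If j > k, comparing first letters (0 for
-- odd, 1 for even indices) shows that j and k have the same parity, and
-- cancelling s₂ repeatedly makes Rⱼ₋ₖ, which begins with 1, a prefix of
-- R₀R₁R₂⋯, which begins with 0.
module Submission where

open import Defs
open import Data.Empty using (⊥-elim)
open import Data.Fin.Patterns using (0F; 1F)
open import Data.List.Base
  using ([]; _∷_; [_]; _++_; _∷ʳ_; length; take; drop; concat; applyUpTo)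
open import Data.List.Properties
  using (∷-injectiveˡ; ∷-injectiveʳ; ++-assoc; ++-identityʳ; ++-cancelˡ; ++-conicalˡ;
         concat-++; concatMap-++; applyUpTo-∷ʳ; take++drop≡id; length-++)
open import Data.Nat.Base
  using (ℕ; zero; suc; _+_; _≤_; _<_; _≥_; _⊔_; z≤n; s≤s; s≤s⁻¹; z<s; s<s; parity)
open import Data.Nat.Induction using (<-rec)
open import Data.Nat.Properties
  using (≤-trans; m≤n+m; m≤m⊔n; m≤n⊔m; +-identityʳ; +-suc; <-cmp)
open import Data.Parity.Base using (Parity; 0ℙ; 1ℙ; _⁻¹)
open import Data.Parity.Properties using (⁻¹-selfInverse; ⁻¹-injective; suc-homo-⁻¹)
open import Data.Product.Base using (_×_; _,_; ∃-syntax)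
open import Function.Base using (_∘_)
open import Function.Definitions using (Injective)
open import Relation.Binary.Definitions using (tri<; tri≈; tri>)
open import Relation.Binary.PropositionalEquality
  using (_≡_; _≢_; refl; sym; trans; cong; cong₂; subst; module ≡-Reasoning)
open import Relation.Nullary.Negation using (¬_)

open ≡-Reasoning

-- Prefixes and products of words

infix 4 _⊑_

_⊑_ : Word → Word → Set
u ⊑ w = ∃[ v ] u ++ v ≡ w

take-++ : ∀ m (u v : Word) → m ≤ length u → take m (u ++ v) ≡ take m u
take-++ zero    u       v _         = refl
take-++ (suc m) (a ∷ u) v (s≤s m≤u) = cong (a ∷_) (take-++ m u v m≤u)

take-length-++ : (u v : Word) → take (length u) (u ++ v) ≡ u
take-length-++ []      v = refl
take-length-++ (a ∷ u) v = cong (a ∷_) (take-length-++ u v)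

applyUpTo-cong : ∀ {A : Set} {f g : ℕ → A} n → (∀ {i} → i < n → f i ≡ g i) →
                 applyUpTo f n ≡ applyUpTo g n
applyUpTo-cong zero    f≗g = refl
applyUpTo-cong (suc n) f≗g = cong₂ _∷_ (f≗g z<s) (applyUpTo-cong n (f≗g ∘ s<s))

∏ : (ℕ → Word) → ℕ → Word
∏ w n = concat (applyUpTo w n)

∏-+ : ∀ w m n → ∏ w (m + n) ≡ ∏ w m ++ ∏ (λ i → w (m + i)) n
∏-+ w zero    n = refl
∏-+ w (suc m) n = trans (cong (w 0 ++_) (∏-+ (w ∘ suc) m n)) (sym (++-assoc (w 0) _ _))

∏-suc : ∀ w n → ∏ w (suc n) ≡ ∏ w n ++ w n
∏-suc w n = begin
  concat (applyUpTo w (suc n))              ≡⟨ cong concat (applyUpTo-∷ʳ w n) ⟨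
  concat (applyUpTo w n ∷ʳ w n)             ≡⟨ concat-++ (applyUpTo w n) [ w n ] ⟨
  ∏ w n ++ (w n ++ [])                      ≡⟨ cong (∏ w n ++_) (++-identityʳ (w n)) ⟩
  ∏ w n ++ w n                              ∎

n≤length-∏ : ∀ w → (∀ i → w i ≢ []) → ∀ n → n ≤ length (∏ w n)
n≤length-∏ w w≢[] zero    = z≤n
n≤length-∏ w w≢[] (suc n) with w 0 in w₀≡
... | []    = ⊥-elim (w≢[] 0 w₀≡)
... | a ∷ u = s≤s (subst (n ≤_) (sym (length-++ u))
                (≤-trans (n≤length-∏ (w ∘ suc) (w≢[] ∘ suc) n) (m≤n+m _ (length u))))

-- Further factors only extend `∏ w n`, so it is a prefix of `x`, and the products of `w′`
-- eventually agree with `x` on that length.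
∏-prefix : ∀ {x w w′} → x ≈∏ w → x ≈∏ w′ → ∀ n → ∃[ N ] (∀ m → m ≥ N → ∏ w n ⊑ ∏ w′ m)
∏-prefix {x} {w} {w′} x≈w x≈w′ n with x≈w (length (∏ w n)) | x≈w′ (length (∏ w n))
... | M , w-eq | N , w′-eq = N , λ m m≥N → drop ℓ (∏ w′ m) , (begin
  ∏ w n ++ drop ℓ (∏ w′ m)             ≡⟨ cong (_++ drop ℓ (∏ w′ m)) (prefix m m≥N) ⟩
  take ℓ (∏ w′ m) ++ drop ℓ (∏ w′ m)   ≡⟨ take++drop≡id ℓ (∏ w′ m) ⟩
  ∏ w′ m                               ∎)
  where
  ℓ = length (∏ w n)

  prefix : ∀ m → m ≥ N → ∏ w n ≡ take ℓ (∏ w′ m)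
  prefix m m≥N = begin
    ∏ w n                                      ≡⟨ take-length-++ (∏ w n) _ ⟨
    -- Convergence is available only from index `M` on; `n + M` factors reach it and still start
    -- with the first `n`.
    take ℓ (∏ w n ++ ∏ (λ i → w (n + i)) M)    ≡⟨ cong (take ℓ) (∏-+ w n M) ⟨
    take ℓ (∏ w (n + M))                       ≡⟨ w-eq (n + M) (m≤n+m M n) ⟩
    applyUpTo x ℓ                              ≡⟨ w′-eq m m≥N ⟨
    take ℓ (∏ w′ m)                            ∎

-- The padded recursion for the kernel words

pad : Parity → Word
pad 0ℙ = []
pad 1ℙ = [ 0F ]

initial : Parity → Letter
initial 0ℙ = 1F
initial 1ℙ = 0F

initial-injective : Injective _≡_ _≡_ initial
initial-injective {0ℙ} {0ℙ} _ = refl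
initial-injective {1ℙ} {1ℙ} _ = refl

parity-suc : ∀ n → parity (suc n) ≡ parity n ⁻¹
parity-suc n = sym (⁻¹-selfInverse (suc-homo-⁻¹ n))

parity-suc-injective : ∀ m n → parity (suc m) ≡ parity (suc n) → parity m ≡ parity n
parity-suc-injective m n eq =
  ⁻¹-injective (trans (sym (parity-suc m)) (trans eq (parity-suc n)))

R-step : ∀ i → R (suc i) ≡ kernelStep (parity i ⁻¹) (R i)
R-step 0 = refl
R-step 1 = refl
R-step 2 = refl
R-step 3 = refl
R-step i@(suc (suc (suc (suc _)))) = cong (λ p → kernelStep p (R i)) (parity-suc i)

kernelStep-initial : ∀ p v → ∃[ u ] kernelStep (p ⁻¹) (initial p ∷ v) ≡ initial (p ⁻¹) ∷ u
kernelStep-initial 0ℙ v = _ , refl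
kernelStep-initial 1ℙ v = _ , refl

-- For `p = 1ℙ` the left padding restores the 0 that `0⁻¹` deletes; for `p = 0ℙ` the right padding
-- is the appended 0.
kernelStep-pad : ∀ p v →
  pad p ++ kernelStep (p ⁻¹) (initial p ∷ v) ≡ s₂ (initial p ∷ v) ++ pad (p ⁻¹)
kernelStep-pad 0ℙ v = refl
kernelStep-pad 1ℙ v = sym (++-identityʳ _)

R-initial : ∀ i → ∃[ v ] R (suc i) ≡ initial (parity (suc i)) ∷ v
R-initial zero    = [] , refl
R-initial (suc i) with R-initial i
... | v , eq with kernelStep-initial (parity (suc i)) v
... | u , step = u , (begin
  R (suc (suc i))                      ≡⟨ R-step (suc i) ⟩
  kernelStep (p ⁻¹) (R (suc i))        ≡⟨ cong (kernelStep (p ⁻¹)) eq ⟩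
  kernelStep (p ⁻¹) (initial p ∷ v)    ≡⟨ step ⟩
  initial (p ⁻¹) ∷ u                   ≡⟨ cong (λ q → initial q ∷ u) (suc-homo-⁻¹ i) ⟩
  initial (parity i) ∷ u               ∎)
  where p = parity (suc i)

R-nonempty : ∀ i → R (suc i) ≢ []
R-nonempty i Rᵢ≡[] with R-initial i
... | v , eq with () ← trans (sym eq) Rᵢ≡[]

R-pad : ∀ i → pad (parity i) ++ R (suc i) ≡ s₂ (R i) ++ pad (parity (suc i))
R-pad zero    = refl
R-pad (suc i) with R-initial i
... | v , eq = begin
  pad p ++ R (suc (suc i))                       ≡⟨ cong (pad p ++_) (R-step (suc i)) ⟩
  pad p ++ kernelStep (p ⁻¹) (R (suc i))         ≡⟨ cong (λ r → pad p ++ kernelStep (p ⁻¹) r) eq ⟩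
  pad p ++ kernelStep (p ⁻¹) (initial p ∷ v)     ≡⟨ kernelStep-pad p v ⟩
  s₂ (initial p ∷ v) ++ pad (p ⁻¹)               ≡⟨ cong (λ r → s₂ r ++ pad (p ⁻¹)) eq ⟨
  s₂ (R (suc i)) ++ pad (p ⁻¹)                   ≡⟨ cong (λ q → s₂ (R (suc i)) ++ pad q) (suc-homo-⁻¹ i) ⟩
  s₂ (R (suc i)) ++ pad (parity i)               ∎
  where p = parity (suc i)

-- Telescoping and the product formula for `P₂`

∏R : ℕ → ℕ → Word
∏R k = ∏ (λ i → R (k + i))

-- The right padding of each image is the left padding that the next kernel word needs, so only the
-- outermost paddings survive.
∏R-pad : ∀ k m → pad (parity k) ++ ∏R (suc k) m ≡ s₂ (∏R k m) ++ pad (parity (k + m))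
∏R-pad k zero    = trans (++-identityʳ _) (cong (pad ∘ parity) (sym (+-identityʳ k)))
∏R-pad k (suc m) = begin
  pad (parity k) ++ ∏R (suc k) (suc m)
    ≡⟨ cong (pad (parity k) ++_) (∏-suc _ m) ⟩
  pad (parity k) ++ (∏R (suc k) m ++ R (suc (k + m)))
    ≡⟨ ++-assoc (pad (parity k)) _ _ ⟨
  (pad (parity k) ++ ∏R (suc k) m) ++ R (suc (k + m))
    ≡⟨ cong (_++ R (suc (k + m))) (∏R-pad k m) ⟩
  (s₂ (∏R k m) ++ pad (parity (k + m))) ++ R (suc (k + m))
    ≡⟨ ++-assoc (s₂ (∏R k m)) _ _ ⟩
  s₂ (∏R k m) ++ (pad (parity (k + m)) ++ R (suc (k + m)))
    ≡⟨ cong (s₂ (∏R k m) ++_) (R-pad (k + m)) ⟩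
  s₂ (∏R k m) ++ (s₂ (R (k + m)) ++ pad (parity (suc (k + m))))
    ≡⟨ ++-assoc (s₂ (∏R k m)) _ _ ⟨
  (s₂ (∏R k m) ++ s₂ (R (k + m))) ++ pad (parity (suc (k + m)))
    ≡⟨ cong (_++ pad (parity (suc (k + m)))) (concatMap-++ s₂-letter (∏R k m) (R (k + m))) ⟨
  s₂ (∏R k m ++ R (k + m)) ++ pad (parity (suc (k + m)))
    ≡⟨ cong₂ (λ u n → s₂ u ++ pad (parity n)) (∏-suc _ m) (+-suc k m) ⟨
  s₂ (∏R k (suc m)) ++ pad (parity (k + suc m))
    ∎

-- The image of a letter is 0 followed by another letter, so taking off at most one 0 leaves a
-- nonempty word.
s₂-pad : ∀ p a v → ∃[ b ] ∃[ u ] pad p ++ b ∷ u ≡ s₂ (a ∷ v)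
s₂-pad 0ℙ 0F v = _ , _ , refl
s₂-pad 0ℙ 1F v = _ , _ , refl
s₂-pad 1ℙ 0F v = _ , _ , refl
s₂-pad 1ℙ 1F v = _ , _ , refl

-- The remainder a ∷ v is nonempty, so that its image under s₂ can absorb the
-- padding in the next step.
∏R-prefix : ∀ n → ∃[ a ] ∃[ v ] ∏R 1 n ++ a ∷ v ≡ s₂^ n [0]
∏R-prefix zero    = _ , _ , refl
∏R-prefix (suc n) with ∏R-prefix n
... | a , v , eq with s₂-pad (parity (suc n)) a v
... | b , u , pad-eq = b , u , (begin
  -- For `k = 0` the left padding is empty, and since `R 0` is empty, `∏R 0 (suc n)` reduces to
  -- `∏R 1 n`.
  ∏R 1 (suc n) ++ b ∷ u                             ≡⟨ cong (_++ b ∷ u) (∏R-pad 0 (suc n)) ⟩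
  (s₂ (∏R 1 n) ++ pad (parity (suc n))) ++ b ∷ u    ≡⟨ ++-assoc (s₂ (∏R 1 n)) _ _ ⟩
  s₂ (∏R 1 n) ++ (pad (parity (suc n)) ++ b ∷ u)    ≡⟨ cong (s₂ (∏R 1 n) ++_) pad-eq ⟩
  s₂ (∏R 1 n) ++ s₂ (a ∷ v)                         ≡⟨ concatMap-++ s₂-letter (∏R 1 n) (a ∷ v) ⟨
  s₂ (∏R 1 n ++ a ∷ v)                              ≡⟨ cong s₂ eq ⟩
  s₂^ suc n [0]                                     ∎)

P₂≈∏R : P₂ ≈∏ (λ i → R (suc i))
P₂≈∏R m with P₂-limit m
-- `N` serves the limit; `m` nonempty factors ensure at least `m` letters.
... | N , limit = N ⊔ m , converges
  where
  converges : ∀ n → n ≥ N ⊔ m → take m (∏R 1 n) ≡ applyUpTo P₂ m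
  converges n n≥ with ∏R-prefix n
  ... | a , v , eq = begin
    take m (∏R 1 n)             ≡⟨ take-++ m (∏R 1 n) (a ∷ v) m≤length ⟨
    take m (∏R 1 n ++ a ∷ v)    ≡⟨ cong (take m) eq ⟩
    take m (s₂^ n [0])          ≡⟨ limit n (≤-trans (m≤m⊔n N m) n≥) ⟩
    applyUpTo P₂ m              ∎
    where
    m≤length : m ≤ length (∏R 1 n)
    m≤length = ≤-trans (≤-trans (m≤n⊔m N m) n≥) (n≤length-∏ _ R-nonempty n)

-- Later kernel words are not prefixes of the remaining product

s₂-cancel-⊑ : ∀ u w p {v} → s₂ u ++ v ≡ s₂ w ++ pad p → u ⊑ w
s₂-cancel-⊑ []       w        p  _  = w , refl
-- The image of a letter has two letters, too many for the padding.
s₂-cancel-⊑ (0F ∷ u) []       0ℙ ()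
s₂-cancel-⊑ (0F ∷ u) []       1ℙ ()
s₂-cancel-⊑ (1F ∷ u) []       0ℙ ()
s₂-cancel-⊑ (1F ∷ u) []       1ℙ ()
s₂-cancel-⊑ (0F ∷ u) (0F ∷ w) p eq with s₂-cancel-⊑ u w p (∷-injectiveʳ (∷-injectiveʳ eq))
... | v , refl = v , refl
s₂-cancel-⊑ (1F ∷ u) (1F ∷ w) p eq with s₂-cancel-⊑ u w p (∷-injectiveʳ (∷-injectiveʳ eq))
... | v , refl = v , refl
-- The images 01 and 00 differ in their second letter.
s₂-cancel-⊑ (0F ∷ u) (1F ∷ w) p ()
s₂-cancel-⊑ (1F ∷ u) (0F ∷ w) p ()

-- Equal parities give equal left paddings, so the prefix relation can be pulled back through `s₂`,
-- lowering both indices by one until `k` is 0.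
R⋢∏R-sameParity : ∀ {j k} m → k < j → parity j ≡ parity k → ¬ (R j ⊑ ∏R k m)
R⋢∏R-sameParity {suc j} {zero} m _ par (v , eq) with R-initial j
-- The positive index is even, so its word begins with 1. As `R 0` is empty, the product is empty
-- for `m` at most 1; afterwards it begins with the 0 of `R 1`.
... | u , Rⱼ≡ rewrite Rⱼ≡ | par with m | eq
... | zero        | ()
... | suc zero    | ()
... | suc (suc _) | ()
R⋢∏R-sameParity {suc j} {suc k} m k<j par (v , eq) =
  R⋢∏R-sameParity m (s≤s⁻¹ k<j) parⱼₖ
    (s₂-cancel-⊑ (R j) (∏R k m) (parity (k + m)) (begin
      s₂ (R j) ++ (pad (parity (suc j)) ++ v)    ≡⟨ ++-assoc (s₂ (R j)) _ _ ⟨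
      (s₂ (R j) ++ pad (parity (suc j))) ++ v    ≡⟨ cong (_++ v) (R-pad j) ⟨
      (pad (parity j) ++ R (suc j)) ++ v         ≡⟨ ++-assoc (pad (parity j)) _ _ ⟩
      pad (parity j) ++ (R (suc j) ++ v)         ≡⟨ cong₂ (λ p u → pad p ++ u) parⱼₖ eq ⟩
      pad (parity k) ++ ∏R (suc k) m             ≡⟨ ∏R-pad k m ⟩
      s₂ (∏R k m) ++ pad (parity (k + m))        ∎))
  where
  parⱼₖ : parity j ≡ parity k
  parⱼₖ = parity-suc-injective j k par

R⊑∏R⇒sameParity : ∀ j k m → R (suc j) ⊑ ∏R (suc k) m → parity (suc j) ≡ parity (suc k)
R⊑∏R⇒sameParity j k zero    (v , eq) = ⊥-elim (R-nonempty j (++-conicalˡ _ v eq))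
R⊑∏R⇒sameParity j k (suc m) (v , eq) with R-initial j | R-initial k
... | _ , Rⱼ≡ | _ , Rₖ≡ rewrite +-identityʳ k | Rⱼ≡ | Rₖ≡ =
  initial-injective (∷-injectiveˡ eq)

R⋢∏R : ∀ {j k} m → k < j → ¬ (R (suc j) ⊑ ∏R (suc k) m)
R⋢∏R {j} {k} m k<j R⊑ = R⋢∏R-sameParity m (s<s k<j) (R⊑∏R⇒sameParity j k m R⊑) R⊑

R-suc-≢ : ∀ {i j} → i < j → R (suc j) ≢ R (suc i)
-- Equal words would be prefixes of each other, already with a single factor.
R-suc-≢ {i} {j} i<j eq = R⋢∏R 1 i<j ([] , (begin
  R (suc j) ++ []          ≡⟨ cong (_++ []) eq ⟩
  R (suc i) ++ []          ≡⟨ cong (λ n → R (suc n) ++ []) (+-identityʳ i) ⟨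
  ∏R (suc i) 1             ∎))

R-suc-injective : Injective _≡_ _≡_ (λ i → R (suc i))
R-suc-injective {i} {j} eq with <-cmp i j
... | tri< i<j _ _ = ⊥-elim (R-suc-≢ i<j (sym eq))
... | tri≈ _ i≡j _ = i≡j
... | tri> _ _ j<i = ⊥-elim (R-suc-≢ j<i eq)

-- Existence and uniqueness of the factorization

R-factorization : KernelFactorization P₂ (λ i → R (suc i))
R-factorization = record
  { kernel   = λ k → suc k , refl
  ; nonempty = R-nonempty
  ; distinct = R-suc-injective
  ; product  = P₂≈∏R
  }

-- The first `i` factors coincide and can be cancelled from both products.
next-⊑ : ∀ {x w w′} → x ≈∏ w → x ≈∏ w′ → ∀ i → (∀ {j} → j < i → w j ≡ w′ j) →
         ∃[ m ] w i ⊑ ∏ (λ j → w′ (i + j)) m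
next-⊑ {w = w} {w′} x≈w x≈w′ i agree with ∏-prefix x≈w x≈w′ (suc i)
... | N , prefix with prefix (i + N) (m≤n+m N i)
... | v , eq = N , v , ++-cancelˡ (∏ w′ i) _ _ (begin
  ∏ w′ i ++ (w i ++ v)                  ≡⟨ cong (λ u → concat u ++ (w i ++ v)) (applyUpTo-cong i agree) ⟨
  ∏ w i ++ (w i ++ v)                   ≡⟨ ++-assoc (∏ w i) _ _ ⟨
  (∏ w i ++ w i) ++ v                   ≡⟨ cong (_++ v) (∏-suc w i) ⟨
  ∏ w (suc i) ++ v                      ≡⟨ eq ⟩
  ∏ w′ (i + N)                          ≡⟨ ∏-+ w′ i N ⟩
  ∏ w′ i ++ ∏ (λ j → w′ (i + j)) N      ∎)

factorization-unique : ∀ w → KernelFactorization P₂ w → ∀ i → w i ≡ R (suc i)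
factorization-unique w F = <-rec (λ i → w i ≡ R (suc i)) step
  where
  open KernelFactorization F

  step : ∀ i → (∀ {j} → j < i → w j ≡ R (suc j)) → w i ≡ R (suc i)
  step i agree with kernel i
  ... | zero  , wᵢ≡ = ⊥-elim (nonempty i wᵢ≡)
  ... | suc j , wᵢ≡ with <-cmp i j
  ... | tri≈ _ refl _ = wᵢ≡
  -- `R (suc j)` already occurs as the factor `w j`, against distinctness.
  ... | tri> _ i≢j j<i = ⊥-elim (i≢j (distinct (trans wᵢ≡ (sym (agree j<i)))))
  ... | tri< i<j _ _ with next-⊑ product P₂≈∏R i agree
  ... | m , wᵢ⊑ = ⊥-elim (R⋢∏R m i<j (subst (_⊑ ∏R (suc i) m) wᵢ≡ wᵢ⊑))

proposition2 : (P₂ ≈∏ (λ i → R (suc i)))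
    × (applyUpTo (λ i → R (suc i)) 5
    ≡ (0F ∷ [])
    ∷ (1F ∷ [])
    ∷ (0F ∷ 0F ∷ 0F ∷ [])
    ∷ (1F ∷ 0F ∷ 1F ∷ 0F ∷ 1F ∷ [])
    ∷ (0F ∷ 0F ∷ 0F ∷ 1F ∷ 0F ∷ 0F ∷ 0F ∷ 1F ∷ 0F ∷ 0F ∷ 0F ∷ [])
    ∷ [])
    × KernelFactorization P₂ (λ i → R (suc i))
    × (∀ (w : ℕ → Word) → KernelFactorization P₂ w → ∀ i → w i ≡ R (suc i))
proposition2 = P₂≈∏R , refl , R-factorization , factorization-unique
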